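{- If $G$ is a finite connected unicyclic graph, then $D'(G) = D(G)$.
   Context: A unicyclic graph is a graph containing exactly one cycle. $D(G)$ (the distinguishing number) is the least number $r$ of labels in a vertex labeling $V(G)\to\{1,\dots,r\}$ preserved by no non-identity automorphism of $G$; $D'(G)$ (the distinguishing index) is the least number of labels in an edge labeling preserved by no non-identity automorphism of $G$. -}

module Defs where

open import Data.Nat using (ℕ; zero; suc; _≤_; _≥_)
open import Data.Fin using (Fin; zero; suc; inject₁; fromℕ)
open import Data.Bool using (Bool; true; false)
open import Data.Product using (Σ; ∃; _×_; _,_)
open import Data.Sum using (_⊎_)
open import Function.Definitions using (Injective)
open import Function.Bundles using (_⇔_)
open import Relation.Binary.PropositionalEquality using (_≡_)
open import Data.Fin.Permutation using (Permutation′; _⟨$⟩ʳ_)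

record Graph : Set where
  field
    n     : ℕ
    Adj   : Fin n → Fin n → Bool
    sym   : ∀ u v → Adj u v ≡ Adj v u
    irref : ∀ v → Adj v v ≡ false
open Graph public

Edge : (G : Graph) → Fin (n G) → Fin (n G) → Set
Edge G u v = Adj G u v ≡ true

data Walk (G : Graph) : Fin (n G) → Fin (n G) → Set where
  nil  : ∀ {v} → Walk G v v
  cons : ∀ {u w v} → Edge G u w → Walk G w v → Walk G u v

Connected : Graph → Set
Connected G = ∀ u v → Walk G u v

record Cycle (G : Graph) : Set where
  field
    k      : ℕ
    k≥2    : k ≥ 2
    vtx    : Fin (suc k) → Fin (n G)
    inj    : Injective _≡_ _≡_ vtx
    step   : ∀ (i : Fin k) → Edge G (vtx (inject₁ i)) (vtx (suc i))
    close  : Edge G (vtx (fromℕ k)) (vtx zero)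
open Cycle public

CycleEdge : {G : Graph} → Cycle G → Fin (n G) → Fin (n G) → Set
CycleEdge {G} C u v =
  (Σ (Fin (k C)) λ i →
     (u ≡ vtx C (inject₁ i) × v ≡ vtx C (suc i))
     ⊎ (v ≡ vtx C (inject₁ i) × u ≡ vtx C (suc i)))
  ⊎ ((u ≡ vtx C (fromℕ (k C)) × v ≡ vtx C zero)
     ⊎ (v ≡ vtx C (fromℕ (k C)) × u ≡ vtx C zero))

SameCycle : {G : Graph} → Cycle G → Cycle G → Set
SameCycle C C' = ∀ u v → CycleEdge C u v ⇔ CycleEdge C' u v

Unicyclic : Graph → Set
Unicyclic G = Cycle G × (∀ (C C' : Cycle G) → SameCycle C C')

IsAut : (G : Graph) → Permutation′ (n G) → Set
IsAut G σ = ∀ u v → Adj G (σ ⟨$⟩ʳ u) (σ ⟨$⟩ʳ v) ≡ Adj G u v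

IsIdentity : {m : ℕ} → Permutation′ m → Set
IsIdentity σ = ∀ v → σ ⟨$⟩ʳ v ≡ v

DistVertexLabeling : (G : Graph) (r : ℕ) → (Fin (n G) → Fin r) → Set
DistVertexLabeling G r f =
  ∀ σ → IsAut G σ → (∀ v → f (σ ⟨$⟩ʳ v) ≡ f v) → IsIdentity σ

-- Edge labelings with r labels: a label for each edge {u,v}, represented
-- by a function on ordered pairs that is symmetric on edges.
IsEdgeLabeling : (G : Graph) (r : ℕ) → (Fin (n G) → Fin (n G) → Fin r) → Set
IsEdgeLabeling G r g = ∀ u v → Edge G u v → g u v ≡ g v u

DistEdgeLabeling : (G : Graph) (r : ℕ) → (Fin (n G) → Fin (n G) → Fin r) → Set
DistEdgeLabeling G r g =
  ∀ σ → IsAut G σ →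
    (∀ u v → Edge G u v → g (σ ⟨$⟩ʳ u) (σ ⟨$⟩ʳ v) ≡ g u v) → IsIdentity σ

HasDistVertexLabeling : Graph → ℕ → Set
HasDistVertexLabeling G r = Σ (Fin (n G) → Fin r) (DistVertexLabeling G r)

HasDistEdgeLabeling : Graph → ℕ → Set
HasDistEdgeLabeling G r =
  Σ (Fin (n G) → Fin (n G) → Fin r) λ g →
    IsEdgeLabeling G r g × DistEdgeLabeling G r g

IsDistNumber : Graph → ℕ → Set
IsDistNumber G r =
  HasDistVertexLabeling G r × (∀ s → HasDistVertexLabeling G s → r ≤ s)

IsDistIndex : Graph → ℕ → Set
IsDistIndex G r =
  HasDistEdgeLabeling G r × (∀ s → HasDistEdgeLabeling G s → r ≤ s)

{-# OPTIONS --safe #-}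
-- Orient G so that every vertex v has one outgoing edge {v , par v}: off the cycle par v is the
-- neighbour nearer to the cycle, on the cycle it is the previous vertex. Every edge arises exactly
-- once, since any other edge could be closed to a second cycle. Off the cycle v ↦ {v , par v}
-- commutes with automorphisms and so carries labels back and forth. On the cycle automorphisms act
-- through the dihedral group, whose reflections do not commute with it; there it is enough
-- to replace a labelling of the vertices by one of the edges (or conversely) with no larger
-- stabiliser. An asymmetric labelling does this if there are three labels, or two labels and at
-- least six vertices; with one label there is nothing to do, and with two labels and at most five
-- vertices a replacement is found by exhaustive search.
module Submission where

open import Defs
open import Data.Nat using (ℕ)
open import Data.Product using (Σ; _×_)
open import Data.Bool using (true)
import Data.Bool.Properties as Bool
open import Data.Empty using (⊥-elim)
open import Data.Fin using (Fin; zero; suc; inject₁; fromℕ; toℕ; finToFun; funToFin)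
open import Data.Fin.Induction using (<-weakInduction; >-weakInduction)
open import Data.Fin.Permutation
  using (Permutation′; permutation; flip; _⟨$⟩ʳ_; _⟨$⟩ˡ_; inverseˡ; inverseʳ)
open import Data.Fin.Properties
  using (all?; any?; toℕ-inject₁; toℕ-fromℕ; toℕ<n; fromℕ≢inject₁; inject₁-injective;
         finToFun-funToFin)
  renaming (_≟_ to _≟ᶠ_)
open import Data.Nat as ℕ using (zero; suc; _≤_; _<_; z≤n; s≤s; _∸_; _^_)
open import Data.Nat.Induction using (<-wellFounded)
import Data.Nat.Properties as ℕ
open import Data.Product using (∃; _,_; proj₁; proj₂)
open import Data.Sum using (_⊎_; inj₁; inj₂; [_,_]′)
open import Function using (_∘_; id)
open import Function.Bundles using (Equivalence)
open import Induction.WellFounded using (Acc; acc)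
open import Relation.Binary.Construct.Closure.ReflexiveTransitive
  using (Star; ε; _◅_; _◅◅_; reverse)
open import Relation.Binary.PropositionalEquality
  using (_≡_; _≢_; refl; trans; cong; cong₂; subst; _≗_)
  renaming (sym to ≡-sym)
open import Relation.Nullary using (¬_; Dec; yes; no)
open import Relation.Nullary.Decidable using (_→-dec_; _×-dec_; map′; from-yes)

private
  variable
    l m q r : ℕ

-- Symmetries of a cycle

prev : Fin (suc l) → Fin (suc l)
prev zero    = fromℕ _
prev (suc i) = inject₁ i

prev-injective : {i j : Fin (suc l)} → prev i ≡ prev j → i ≡ j
prev-injective {i = zero}  {zero}  _  = refl
prev-injective {i = zero}  {suc j} eq = ⊥-elim (fromℕ≢inject₁ eq)
prev-injective {i = suc i} {zero}  eq = ⊥-elim (fromℕ≢inject₁ (≡-sym eq))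
prev-injective {i = suc i} {suc j} eq = cong suc (inject₁-injective eq)

prev²≢id : 2 ≤ l → (i : Fin (suc l)) → prev (prev i) ≢ i
prev²≢id (s≤s (s≤s _)) zero          ()
prev²≢id (s≤s (s≤s _)) (suc zero)    ()
prev²≢id (s≤s (s≤s _)) (suc (suc i)) eq = ℕ.<⇒≢ (ℕ.m<n⇒m<1+n (ℕ.n<1+n (toℕ i)))
  (trans (≡-sym (trans (toℕ-inject₁ (inject₁ i)) (toℕ-inject₁ i))) (cong toℕ eq))

-- The reflection equation is `τ ∘ prev = next ∘ τ`, with the inverse `next` of `prev` moved to the
-- other side.
Rotation Reflection : (Fin (suc l) → Fin (suc l)) → Set
Rotation   τ = ∀ i → τ (prev i) ≡ prev (τ i)
Reflection τ = ∀ i → prev (τ (prev i)) ≡ τ i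

-- The second index is the action on the edges of the cycle, where edge i joins prev i and i.
data Dihedral {l} (τ : Fin (suc l) → Fin (suc l)) : (Fin (suc l) → Fin (suc l)) → Set where
  rotation   : Rotation τ → Dihedral τ τ
  reflection : Reflection τ → Dihedral τ (τ ∘ prev)

Preserves : (Fin m → Fin r) → (Fin m → Fin m) → Set
Preserves f τ = ∀ i → f (τ i) ≡ f i

preserves-resp : {f g : Fin m → Fin r} {τ υ : Fin m → Fin m} →
                 f ≗ g → τ ≗ υ → Preserves f τ → Preserves g υ
preserves-resp {g = g} {τ = τ} f≗g τ≗υ p i =
  trans (cong g (≡-sym (τ≗υ i))) (trans (≡-sym (f≗g (τ i))) (trans (p i) (f≗g i)))

-- The orientation in which `τ` maps edge `zero` propagates around the cycle: if two consecutive
-- edges were mapped with opposite orientations, `τ` would identify `prev (prev i)` with `i`.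
adjacency-preserving⇒dihedral : 2 ≤ l → (τ : Fin (suc l) → Fin (suc l)) →
  (∀ {i j} → τ i ≡ τ j → i ≡ j) →
  (∀ i → τ (prev i) ≡ prev (τ i) ⊎ prev (τ (prev i)) ≡ τ i) →
  Rotation τ ⊎ Reflection τ
adjacency-preserving⇒dihedral 2≤l τ inj adj with adj zero
... | inj₁ p = inj₁ (<-weakInduction _ p λ i q →
    [ id , (λ q′ → ⊥-elim (clash (suc i) q q′)) ]′ (adj (suc i)))
  where
  clash : ∀ i → τ (prev (prev i)) ≡ prev (τ (prev i)) → prev (τ (prev i)) ≢ τ i
  clash i q q′ = prev²≢id 2≤l i (inj (trans q q′))
... | inj₂ p = inj₂ (<-weakInduction _ p λ i q →
    [ (λ q′ → ⊥-elim (clash (suc i) q q′)) , id ]′ (adj (suc i)))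
  where
  clash : ∀ i → prev (τ (prev (prev i))) ≡ τ (prev i) → τ (prev i) ≢ prev (τ i)
  clash i q q′ = prev²≢id 2≤l i (inj (prev-injective (trans q q′)))

rotation-fixing-zero : {τ : Fin (suc l) → Fin (suc l)} → Rotation τ → τ zero ≡ zero → ∀ i → τ i ≡ i
rotation-fixing-zero {τ = τ} rot fix =
  <-weakInduction _ fix λ i ih → prev-injective (trans (≡-sym (rot (suc i))) ih)

-- Asymmetric labellings of cycles

Rigid : (Fin (suc l) → Fin r) → Set
Rigid h = (∀ {τ} → Rotation τ → Preserves h τ → ∀ i → τ i ≡ i)
        × (∀ {τ} → Reflection τ → ¬ Preserves h τ)

h₃ : Fin (3 ℕ.+ l) → Fin (3 ℕ.+ r)
h₃ zero          = zero
h₃ (suc zero)    = suc zero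
h₃ (suc (suc _)) = suc (suc zero)

-- Labels 0 and 1 occur once each, so the vertices 0 and 1 are fixed. A reflection fixing both would
-- make 1 the predecessor of 0, impossible with three or more vertices.
h₃-rigid : Rigid (h₃ {l} {r})
h₃-rigid {l} {r} = (λ {τ} rot p → rotation-fixing-zero rot (is-zero (τ zero) (p zero)))
                 , λ {τ} ref p → no-reflection ref p
  where
  is-zero : ∀ x → h₃ {l} {r} x ≡ zero → x ≡ zero
  is-zero zero _ = refl
  is-zero (suc zero) ()
  is-zero (suc (suc _)) ()
  is-one : ∀ x → h₃ {l} {r} x ≡ suc zero → x ≡ suc zero
  is-one zero ()
  is-one (suc zero) _ = refl
  is-one (suc (suc _)) ()
  no-reflection : ∀ {τ} → Reflection τ → ¬ Preserves (h₃ {l} {r}) τ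
  no-reflection {τ} ref p
    with trans (cong prev (≡-sym (is-zero (τ zero) (p zero))))
               (trans (ref (suc zero)) (is-one (τ (suc zero)) (p (suc zero))))
  ... | ()

-- Six vertices are the minimum for this pattern: modulo five, -2 and 3 coincide and the reflection
-- exchanging 0 and 1 preserves it.
h₆ : Fin (6 ℕ.+ l) → Fin 2
h₆ zero                   = suc zero
h₆ (suc zero)             = suc zero
h₆ (suc (suc (suc zero))) = suc zero
h₆ _                      = zero

-- The vertices 0 and 1 form the only adjacent pair labelled 1, and a reflection
-- exchanging them would send the vertex 3 to -2 (modulo the length), which is labelled 0.
h₆-rigid : Rigid (h₆ {l})
h₆-rigid {l} = (λ {τ} rot p → rotation-fixing-zero rot
                   (pair (τ (suc zero)) (τ zero) (rot (suc zero)) (p (suc zero)) (p zero) .proj₁))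
             , no-reflection
  where
  pair : ∀ x y → y ≡ prev x → h₆ {l} x ≡ suc zero → h₆ y ≡ suc zero → y ≡ zero × x ≡ suc zero
  pair zero y refl _ ()
  pair (suc zero) y refl _ _ = refl , refl
  pair (suc (suc zero)) y refl () _
  pair (suc (suc (suc zero))) y refl _ ()
  pair (suc (suc (suc (suc _)))) y refl () _
  no-reflection : ∀ {τ} → Reflection τ → ¬ Preserves (h₆ {l}) τ
  no-reflection {τ} ref p
    with pair (τ zero) (τ (suc zero)) (≡-sym (ref (suc zero))) (p zero) (p (suc zero))
  ... | τ1≡0 , τ0≡1
    with trans (≡-sym (cong h₆ (trans (≡-sym (ref (suc (suc (suc zero)))))
                 (cong prev (trans (≡-sym (ref (suc (suc zero)))) (cong prev τ1≡0))))))
               (p (suc (suc (suc zero))))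
  ... | ()

-- Exhaustive search on short cycles

prev^ : ℕ → Fin (suc l) → Fin (suc l)
prev^ zero    i = i
prev^ (suc n) i = prev (prev^ n i)

-- The parameter `a` is the image of the last vertex under `rot a`, and of `zero` under `ref a`; all
-- other images are reached from it by `prev` alone.
rot ref refᵉ : Fin (suc l) → Fin (suc l) → Fin (suc l)
rot {l} a i = prev^ (l ∸ toℕ i) a
ref a i = prev^ (toℕ i) a
refᵉ a = ref a ∘ prev

rotation⇒rot : {τ : Fin (suc l) → Fin (suc l)} → Rotation τ → rot (τ (fromℕ l)) ≗ τ
rotation⇒rot {l} {τ} isRot = >-weakInduction _
  (cong (λ n → prev^ n (τ (fromℕ l))) (trans (cong (l ∸_) (toℕ-fromℕ l)) (ℕ.n∸n≡0 l)))
  λ i ih → trans (cong (λ n → prev^ n (τ (fromℕ l)))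
                   (trans (cong (l ∸_) (toℕ-inject₁ i)) (ℕ.+-∸-assoc 1 (toℕ<n i))))
             (trans (cong prev ih) (≡-sym (isRot (suc i))))

reflection⇒ref : {τ : Fin (suc l) → Fin (suc l)} → Reflection τ → ref (τ zero) ≗ τ
reflection⇒ref {τ = τ} isRef = <-weakInduction _ refl
  λ i ih → trans (cong (λ n → prev (prev^ n (τ zero))) (≡-sym (toℕ-inject₁ i)))
             (trans (cong prev ih) (isRef (suc i)))

-- The stabiliser of `g` under `ψ` is contained in that of `f` under `φ`, where `φ` and `ψ` are two
-- actions of the same symmetries, indexed by `Fin q`.
Simulates : (φ ψ : Fin q → Fin m → Fin m) (f g : Fin m → Fin r) → Set
Simulates φ ψ f g = ∀ a → Preserves g (ψ a) → Preserves f (φ a)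

simulates? : (φ ψ : Fin q → Fin m → Fin m) (f g : Fin m → Fin r) → Dec (Simulates φ ψ f g)
simulates? φ ψ f g = all? λ a → preserves? g (ψ a) →-dec preserves? f (φ a)
  where
  preserves? : ∀ f τ → Dec (Preserves f τ)
  preserves? f τ = all? λ i → f (τ i) ≟ᶠ f i

bits : Fin (2 ^ m) → Fin m → Fin 2
bits = finToFun

-- One `y` has to serve rotations and reflections together. Stabilisers are compared because cycles
-- of length three to five have no asymmetric labelling with two labels.
TwoLabelSimulation : ∀ l (φ ψ : Fin (suc l) → Fin (suc l) → Fin (suc l)) → Set
TwoLabelSimulation l φ ψ = ∀ x → ∃ λ y →
  Simulates (rot {l}) rot (bits x) (bits y) × Simulates φ ψ (bits x) (bits y)

twoLabelSimulation? : ∀ l φ ψ → Dec (TwoLabelSimulation l φ ψ)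
twoLabelSimulation? l φ ψ = all? λ x → any? λ y →
  simulates? (rot {l}) rot (bits x) (bits y) ×-dec simulates? φ ψ (bits x) (bits y)

triangle-edges : TwoLabelSimulation 2 ref refᵉ
triangle-edges = from-yes (twoLabelSimulation? 2 ref refᵉ)

square-edges : TwoLabelSimulation 3 ref refᵉ
square-edges = from-yes (twoLabelSimulation? 3 ref refᵉ)

pentagon-edges : TwoLabelSimulation 4 ref refᵉ
pentagon-edges = from-yes (twoLabelSimulation? 4 ref refᵉ)

triangle-vertices : TwoLabelSimulation 2 refᵉ ref
triangle-vertices = from-yes (twoLabelSimulation? 2 refᵉ ref)

square-vertices : TwoLabelSimulation 3 refᵉ ref
square-vertices = from-yes (twoLabelSimulation? 3 refᵉ ref)

pentagon-vertices : TwoLabelSimulation 4 refᵉ ref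
pentagon-vertices = from-yes (twoLabelSimulation? 4 refᵉ ref)

-- Exchanging vertex and edge labellings of a cycle

SimulatedOnEdges SimulatedOnVertices : ℕ → ℕ → Set
SimulatedOnEdges l r = (f : Fin (suc l) → Fin r) → ∃ λ (g : Fin (suc l) → Fin r) →
  ∀ {τ τᵉ} → Dihedral τ τᵉ → Preserves g τᵉ → Preserves f τ
SimulatedOnVertices l r = (g : Fin (suc l) → Fin r) → ∃ λ (f : Fin (suc l) → Fin r) →
  ∀ {τ τᵉ} → Dihedral τ τᵉ → Preserves f τ → Preserves g τᵉ

-- With `τ` also `τ ∘ prev` is a reflection, so a rigid labelling is asymmetric for the action on
-- edges too.
rigid⇒edges : {h : Fin (suc l) → Fin r} → Rigid h → SimulatedOnEdges l r
rigid⇒edges {h = h} (rot-id , no-ref) f = h , λ where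
  (rotation isRot)   p i → cong f (rot-id isRot p i)
  (reflection isRef) p   → ⊥-elim (no-ref (λ i → isRef (prev i)) p)

rigid⇒vertices : {h : Fin (suc l) → Fin r} → Rigid h → SimulatedOnVertices l r
rigid⇒vertices {h = h} (rot-id , no-ref) g = h , λ where
  (rotation isRot)   p i → cong g (rot-id isRot p i)
  (reflection isRef) p   → ⊥-elim (no-ref isRef p)

-- The search covers every symmetry, since a rotation or reflection agrees pointwise with some
-- `rot a` or `ref a`.
twoLabel⇒edges : TwoLabelSimulation l ref refᵉ → SimulatedOnEdges l 2
twoLabel⇒edges sim f with sim (funToFin f)
... | y , simRot , simRef = bits y , λ where
  (reflection isRef) p → preserves-resp (finToFun-funToFin f) (reflection⇒ref isRef)
    (simRef _ (preserves-resp (λ _ → refl) (λ i → ≡-sym (reflection⇒ref isRef (prev i))) p))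
  {τ} (rotation isRot) p → preserves-resp (finToFun-funToFin f) (rotation⇒rot isRot)
    (simRot _ (preserves-resp (λ _ → refl) (λ i → ≡-sym (rotation⇒rot {τ = τ} isRot i)) p))

twoLabel⇒vertices : TwoLabelSimulation l refᵉ ref → SimulatedOnVertices l 2
twoLabel⇒vertices sim g with sim (funToFin g)
... | y , simRot , simRef = bits y , λ where
  (reflection isRef) p → preserves-resp (finToFun-funToFin g) (λ i → reflection⇒ref isRef (prev i))
    (simRef _ (preserves-resp (λ _ → refl) (λ i → ≡-sym (reflection⇒ref isRef i)) p))
  {τ} (rotation isRot) p → preserves-resp (finToFun-funToFin g) (rotation⇒rot isRot)
    (simRot _ (preserves-resp (λ _ → refl) (λ i → ≡-sym (rotation⇒rot {τ = τ} isRot i)) p))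

one-label : (x y : Fin 1) → x ≡ y
one-label zero zero = refl

simulatedOnEdges : 2 ≤ l → ∀ r → SimulatedOnEdges l r
simulatedOnEdges _ 0 f with () ← f zero
simulatedOnEdges _ 1 f = f , λ _ _ _ → one-label _ _
simulatedOnEdges {2} _ 2 = twoLabel⇒edges triangle-edges
simulatedOnEdges {3} _ 2 = twoLabel⇒edges square-edges
simulatedOnEdges {4} _ 2 = twoLabel⇒edges pentagon-edges
simulatedOnEdges {suc (suc (suc (suc (suc l))))} _ 2 = rigid⇒edges h₆-rigid
simulatedOnEdges {suc (suc l)} (s≤s (s≤s _)) (suc (suc (suc r))) = rigid⇒edges h₃-rigid
simulatedOnEdges {1} (s≤s ()) 2

simulatedOnVertices : 2 ≤ l → ∀ r → SimulatedOnVertices l r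
simulatedOnVertices _ 0 g with () ← g zero
simulatedOnVertices _ 1 g = g , λ _ _ _ → one-label _ _
simulatedOnVertices {2} _ 2 = twoLabel⇒vertices triangle-vertices
simulatedOnVertices {3} _ 2 = twoLabel⇒vertices square-vertices
simulatedOnVertices {4} _ 2 = twoLabel⇒vertices pentagon-vertices
simulatedOnVertices {suc (suc (suc (suc (suc l))))} _ 2 = rigid⇒vertices h₆-rigid
simulatedOnVertices {suc (suc l)} (s≤s (s≤s _)) (suc (suc (suc r))) = rigid⇒vertices h₃-rigid
simulatedOnVertices {1} (s≤s ()) 2

Least : (ℕ → Set) → ℕ → Set
Least P n = P n × (∀ m → P m → n ≤ m)

-- Used twice: for the distance to the cycle and for the distinguishing number.
least : {P : ℕ → Set} → (∀ n → Dec (P n)) → ∀ n → P n → ∃ (Least P)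
least P? n p with P? 0
least P? n       p | yes p₀ = 0 , p₀ , λ _ _ → z≤n
least P? zero    p | no ¬p₀ = ⊥-elim (¬p₀ p)
least P? (suc n) p | no ¬p₀ with m , pm , min ← least (λ m → P? (suc m)) n p =
  suc m , pm , λ where
    zero    q → ⊥-elim (¬p₀ q)
    (suc l) q → s≤s (min l q)

-- The functional graph underlying a unicyclic graph

module SimplePaths {n : ℕ} (R : Fin n → Fin n → Set) where

  -- Defined together with `at`, because the freshness condition in `extend` speaks of the vertices
  -- already on the path.
  data Path : Fin n → Fin n → Set
  length : ∀ {u v} → Path u v → ℕ
  at : ∀ {u v} (π : Path u v) → Fin (suc (length π)) → Fin n

  data Path where
    nil    : ∀ {v} → Path v v
    extend : ∀ {u w v} → R u w → (π : Path w v) → (∀ i → at π i ≢ u) → Path u v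

  length nil            = 0
  length (extend _ π _) = suc (length π)

  at {u} π zero             = u
  at (extend _ π _) (suc i) = at π i

  at-last : ∀ {u v} (π : Path u v) → at π (fromℕ (length π)) ≡ v
  at-last nil            = refl
  at-last (extend _ π _) = at-last π

  at-injective : ∀ {u v} (π : Path u v) {i j} → at π i ≡ at π j → i ≡ j
  at-injective π {zero} {zero} _ = refl
  at-injective (extend _ π fresh) {zero} {suc j} eq = ⊥-elim (fresh j (≡-sym eq))
  at-injective (extend _ π fresh) {suc i} {zero} eq = ⊥-elim (fresh i eq)
  at-injective (extend _ π fresh) {suc i} {suc j} eq = cong suc (at-injective π eq)

  at-step : ∀ {u v} (π : Path u v) (i : Fin (length π)) → R (at π (inject₁ i)) (at π (suc i))
  at-step (extend e π _) zero    = e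
  at-step (extend _ π _) (suc i) = at-step π i

  suffix : ∀ {u v} (π : Path u v) i → Path (at π i) v
  suffix π zero = π
  suffix (extend _ π _) (suc i) = suffix π i

  -- Loop erasure: if `u` already occurs on the simplified remainder, the suffix from that
  -- occurrence is the new path.
  simplify : ∀ {u v} → Star R u v → Path u v
  simplify ε = nil
  simplify {u} {v} (e ◅ es) with simplify es
  ... | π with any? (λ i → at π i ≟ᶠ u)
  ... | yes (i , eq) = subst (λ x → Path x v) eq (suffix π i)
  ... | no fresh = extend e π λ i eq → fresh (i , eq)

-- Cycles, detours and images under automorphisms

module _ {G : Graph} where

  edge-sym : ∀ {u v} → Edge G u v → Edge G v u
  edge-sym {u} {v} e = trans (sym G v u) e

  edge-irrefl : ∀ {v} → ¬ Edge G v v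
  edge-irrefl {v} e with () ← trans (≡-sym e) (irref G v)

  AvoidingEdge : (u v x y : Fin (n G)) → Set
  AvoidingEdge u v x y = Edge G x y × ¬ (x ≡ u × y ≡ v) × ¬ (x ≡ v × y ≡ u)

  -- After loop erasure the detour is simple, and it has at least two steps because it avoids the
  -- edge itself and `u` differs from `v`. The edge then closes it to a cycle.
  detour⇒cycle : ∀ {u v} → Edge G u v → Star (AvoidingEdge u v) u v →
                 Σ (Cycle G) λ C → CycleEdge C u v
  detour⇒cycle {u} {v} e es = cycle , inj₂ (inj₂ (≡-sym (at-last π) , refl))
    where
    open SimplePaths (AvoidingEdge u v)
    π : Path u v
    π = simplify es
    length≥2 : ∀ (π : Path u v) → 2 ≤ length π
    length≥2 nil = ⊥-elim (edge-irrefl e)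
    length≥2 (extend (_ , ¬uv , _) nil _) = ⊥-elim (¬uv (refl , refl))
    length≥2 (extend _ (extend _ _ _) _) = s≤s (s≤s z≤n)
    cycle : Cycle G
    cycle = record
      { k = length π ; k≥2 = length≥2 π ; vtx = at π ; inj = at-injective π
      ; step = λ i → proj₁ (at-step π i)
      ; close = subst (λ x → Edge G x u) (≡-sym (at-last π)) (edge-sym e) }

  -- Gives all cycle edges one form; the closing edge gets index `zero`, whose `prev` is the last
  -- vertex.
  cycleEdge-prev : (C : Cycle G) → ∀ {u v} → CycleEdge C u v →
    ∃ λ i → (u ≡ vtx C (prev i) × v ≡ vtx C i) ⊎ (v ≡ vtx C (prev i) × u ≡ vtx C i)
  cycleEdge-prev C (inj₁ (i , e)) = suc i , e
  cycleEdge-prev C (inj₂ e)       = zero , e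

  prev-cycleEdge : (C : Cycle G) → ∀ i → CycleEdge C (vtx C (prev i)) (vtx C i)
  prev-cycleEdge C zero    = inj₂ (inj₁ (refl , refl))
  prev-cycleEdge C (suc i) = inj₁ (i , inj₁ (refl , refl))

  prev-edge : (C : Cycle G) → ∀ i → Edge G (vtx C (prev i)) (vtx C i)
  prev-edge C zero    = close C
  prev-edge C (suc i) = step C i

  inverse-isAut : ∀ {σ} → IsAut G σ → IsAut G (flip σ)
  inverse-isAut {σ} aut u v = trans (≡-sym (aut _ _)) (cong₂ (Adj G) (inverseʳ σ) (inverseʳ σ))

  aut-edge : ∀ {σ} → IsAut G σ → ∀ {u v} → Edge G u v → Edge G (σ ⟨$⟩ʳ u) (σ ⟨$⟩ʳ v)
  aut-edge aut e = trans (aut _ _) e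

  perm-injective : ∀ (σ : Permutation′ (n G)) {u v} → σ ⟨$⟩ʳ u ≡ σ ⟨$⟩ʳ v → u ≡ v
  perm-injective σ eq = trans (≡-sym (inverseˡ σ)) (trans (cong (σ ⟨$⟩ˡ_) eq) (inverseˡ σ))

  image : ∀ {σ} → IsAut G σ → Cycle G → Cycle G
  image {σ} aut C = record
    { k = k C ; k≥2 = k≥2 C ; vtx = λ i → σ ⟨$⟩ʳ vtx C i
    ; inj = λ eq → inj C (perm-injective σ eq)
    ; step = λ i → aut-edge {σ} aut (step C i)
    ; close = aut-edge {σ} aut (close C) }

module UnicyclicGraph (G : Graph) (connected : Connected G) (C : Cycle G)
                      (unique : ∀ C₁ C₂ → SameCycle {G} C₁ C₂) where

  V : Set
  V = Fin (n G)

  c : Fin (suc (k C)) → V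
  c = vtx C

  OnCycle : V → Set
  OnCycle v = ∃ λ i → c i ≡ v

  onCycle? : ∀ v → Dec (OnCycle v)
  onCycle? v = any? λ i → c i ≟ᶠ v

  -- A walk of exactly `d` steps to the cycle; the least such `d`, `depth` below, is the distance to
  -- the cycle.
  Reaches : ℕ → V → Set
  Reaches zero    v = OnCycle v
  Reaches (suc d) v = ∃ λ w → Edge G v w × Reaches d w

  reaches? : ∀ d v → Dec (Reaches d v)
  reaches? zero    v = onCycle? v
  reaches? (suc d) v = any? λ w → (Adj G v w Bool.≟ true) ×-dec reaches? d w

  walk⇒reaches : ∀ {v i} → Walk G v (c i) → ∃ λ d → Reaches d v
  walk⇒reaches nil        = 0 , _ , refl
  walk⇒reaches (cons e p) with d , q ← walk⇒reaches p = suc d , _ , e , q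

  -- leastReach and parentOf are opaque so that abstracting over onCycle? v in later proofs
  -- does not rewrite the onCycle? tests hidden inside depth and par.
  abstract
    leastReach : ∀ v → ∃ (Least λ d → Reaches d v)
    leastReach v with d , q ← walk⇒reaches {i = zero} (connected v _) =
      least (λ d → reaches? d v) d q

  depth : V → ℕ
  depth v = proj₁ (leastReach v)

  depth-reaches : ∀ v → Reaches (depth v) v
  depth-reaches v = proj₁ (proj₂ (leastReach v))

  depth-least : ∀ {v d} → Reaches d v → depth v ≤ d
  depth-least {v} {d} = proj₂ (proj₂ (leastReach v)) d

  lower-neighbour : ∀ {d v} → ¬ OnCycle v → Reaches d v → ∃ λ w → Edge G v w × depth w < d
  lower-neighbour {zero}  off r           = ⊥-elim (off r)
  lower-neighbour {suc d} off (w , e , r) = w , e , s≤s (depth-least r)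

  record Parent (v : V) : Set where
    field
      parent     : V
      is-edge    : Edge G v parent
      on-cycle   : ∀ i → c i ≡ v → parent ≡ c (prev i)
      off-cycle  : ¬ OnCycle v → depth parent < depth v

  abstract
    parentOf : ∀ v → Parent v
    parentOf v = choose (onCycle? v)
      where
      choose : Dec (OnCycle v) → Parent v
      choose (yes (i , refl)) = record
        { parent = c (prev i) ; is-edge = edge-sym {G} (prev-edge C i)
        ; on-cycle = λ j eq → cong (λ x → c (prev x)) (inj C (≡-sym eq))
        ; off-cycle = λ off → ⊥-elim (off (i , refl)) }
      choose (no off) with w , e , lt ← lower-neighbour off (depth-reaches v) = record
        { parent = w ; is-edge = e
        ; on-cycle = λ i eq → ⊥-elim (off (i , eq))
        ; off-cycle = λ _ → lt }

  par : V → V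
  par v = Parent.parent (parentOf v)

  par-c : ∀ i → par (c i) ≡ c (prev i)
  par-c i = Parent.on-cycle (parentOf (c i)) i refl

  par-edge : ∀ v → Edge G v (par v)
  par-edge v = Parent.is-edge (parentOf v)

  par-depth : ∀ {v} → ¬ OnCycle v → depth (par v) < depth v
  par-depth {v} = Parent.off-cycle (parentOf v)

  par-onCycle : ∀ {v} → OnCycle v → OnCycle (par v)
  par-onCycle (i , refl) = prev i , ≡-sym (par-c i)

  -- Parents of cycle vertices stay on the cycle and all other parents have smaller depth than their
  -- child.
  lower-not-child : ∀ {v w} → ¬ OnCycle v → depth w < depth v → v ≢ par w
  lower-not-child {v} {w} off lt eq with onCycle? w
  ... | yes on  = off (subst OnCycle (≡-sym eq) (par-onCycle on))
  ... | no offw = ℕ.<-asym lt (subst (λ x → depth x < depth w) (≡-sym eq) (par-depth offw))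

  -- Ensures that no edge is the parent edge of both its ends.
  par²≢id : ∀ v → par (par v) ≢ v
  par²≢id v eq with onCycle? v
  ... | yes (i , refl) = prev²≢id (k≥2 C) i
          (inj C (trans (≡-sym (par-c (prev i))) (trans (cong par (≡-sym (par-c i))) eq)))
  ... | no off = lower-not-child off (par-depth off) (≡-sym eq)

  module _ {R : V → V → Set} (R-sym : ∀ {x y} → R x y → R y x) (R-par : ∀ x → R x (par x)) where

    to-cycle : ∀ v → Acc _<_ (depth v) → ∃ λ i → Star R v (c i)
    to-cycle v (acc rec) with onCycle? v
    ... | yes (i , refl) = i , ε
    ... | no off with i , p ← to-cycle (par v) (rec (par-depth off)) = i , R-par v ◅ p

    to-zero : ∀ i → Star R (c i) (c zero)
    to-zero = <-weakInduction _ ε λ i p → subst (R _) (par-c (suc i)) (R-par (c (suc i))) ◅ p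

    -- Parents lead down to the cycle and then around it to `c zero`. The relation is left general
    -- so that it can be adjacency with one edge removed.
    par-connected : ∀ u v → Star R u v
    par-connected u v = reach u ◅◅ reverse R-sym (reach v)
      where
      reach : ∀ v → Star R v (c zero)
      reach v with i , p ← to-cycle v (<-wellFounded _) = p ◅◅ to-zero i

  -- The parent edges connect the ends of any other edge, which would therefore lie on a cycle. By
  -- uniqueness that cycle has the edges of `C`, but those are all parent edges.
  edge-par : ∀ {u v} → Edge G u v → v ≡ par u ⊎ u ≡ par v
  edge-par {u} {v} e with v ≟ᶠ par u | u ≟ᶠ par v
  ... | yes p | _     = inj₁ p
  ... | _     | yes q = inj₂ q
  ... | no ¬p | no ¬q = ⊥-elim (not-cycleEdge (cycleEdge-prev C
          (Equivalence.to (unique (proj₁ detour) C u v) (proj₂ detour))))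
    where
    detour : Σ (Cycle G) λ D → CycleEdge D u v
    detour = detour⇒cycle e (par-connected
      (λ (e , a , b) → edge-sym {G} e , (λ (p , q) → b (q , p)) , λ (p , q) → a (q , p))
      (λ x → par-edge x , (λ { (refl , q) → ¬p (≡-sym q) }) , λ { (refl , q) → ¬q (≡-sym q) })
      u v)
    not-cycleEdge : ¬ ∃ λ i → (u ≡ c (prev i) × v ≡ c i) ⊎ (v ≡ c (prev i) × u ≡ c i)
    not-cycleEdge (i , inj₁ (refl , refl)) = ¬q (≡-sym (par-c i))
    not-cycleEdge (i , inj₂ (refl , refl)) = ¬p (≡-sym (par-c i))

  -- Action of automorphisms on the cycle and on parents

  MapsEdge : Permutation′ (n G) → (i j : Fin (suc (k C))) → Set
  MapsEdge σ i j = (σ ⟨$⟩ʳ c (prev i) ≡ c (prev j) × σ ⟨$⟩ʳ c i ≡ c j)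
                 ⊎ (σ ⟨$⟩ʳ c i ≡ c (prev j) × σ ⟨$⟩ʳ c (prev i) ≡ c j)

  mapsEdge-label : ∀ σ i {j} {g : V → V → Fin r} → IsEdgeLabeling G r g → MapsEdge σ i j →
                   g (σ ⟨$⟩ʳ c i) (σ ⟨$⟩ʳ c (prev i)) ≡ g (c j) (c (prev j))
  mapsEdge-label _ _ {g = g} _ (inj₁ (p , q)) = cong₂ g q p
  mapsEdge-label _ _ {j} {g} g-sym (inj₂ (p , q)) = trans (cong₂ g p q) (g-sym _ _ (prev-edge C j))

  module _ (σ : Permutation′ (n G)) (aut : IsAut G σ) where

    -- The image of `C` is a cycle, so by uniqueness it has the same edges as `C`.
    σ-cycleEdge : ∀ i → ∃ (MapsEdge σ i)
    σ-cycleEdge i = cycleEdge-prev C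
      (Equivalence.to (unique σC C _ _) (prev-cycleEdge σC i))
      where σC = image {G} {σ} aut C

    σ-onCycle : ∀ {v} → OnCycle v → OnCycle (σ ⟨$⟩ʳ v)
    σ-onCycle (i , refl) with σ-cycleEdge i
    ... | j , inj₁ (_ , q) = j , ≡-sym q
    ... | j , inj₂ (q , _) = prev j , ≡-sym q

    σ-reaches : ∀ d {v} → Reaches d v → Reaches d (σ ⟨$⟩ʳ v)
    σ-reaches zero    r           = σ-onCycle r
    σ-reaches (suc d) (w , e , r) = σ ⟨$⟩ʳ w , aut-edge {G} {σ} aut e , σ-reaches d r

    σ-depth≤ : ∀ v → depth (σ ⟨$⟩ʳ v) ≤ depth v
    σ-depth≤ v = depth-least (σ-reaches _ (depth-reaches v))

  module Automorphism (σ : Permutation′ (n G)) (aut : IsAut G σ) where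

    aut⁻¹ : IsAut G (flip σ)
    aut⁻¹ = inverse-isAut {G} {σ} aut

    σ-depth : ∀ v → depth (σ ⟨$⟩ʳ v) ≡ depth v
    σ-depth v = ℕ.≤-antisym (σ-depth≤ σ aut v)
      (subst (λ x → depth x ≤ depth (σ ⟨$⟩ʳ v)) (inverseˡ σ) (σ-depth≤ (flip σ) aut⁻¹ (σ ⟨$⟩ʳ v)))

    σ-offCycle : ∀ {v} → ¬ OnCycle v → ¬ OnCycle (σ ⟨$⟩ʳ v)
    σ-offCycle off on = off (subst OnCycle (inverseˡ σ) (σ-onCycle (flip σ) aut⁻¹ on))

    -- The image of a parent edge is again a parent edge, and its direction is forced because `σ`
    -- preserves depth. Hence the choice made in `parentOf` does no harm.
    σ-par : ∀ {v} → ¬ OnCycle v → par (σ ⟨$⟩ʳ v) ≡ σ ⟨$⟩ʳ par v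
    σ-par {v} off with edge-par (aut-edge {G} {σ} aut (par-edge v))
    ... | inj₁ p = ≡-sym p
    ... | inj₂ q = ⊥-elim (lower-not-child (σ-offCycle off) lt q)
      where
      lt : depth (σ ⟨$⟩ʳ par v) < depth (σ ⟨$⟩ʳ v)
      lt rewrite σ-depth (par v) | σ-depth v = par-depth off

    τ : Fin (suc (k C)) → Fin (suc (k C))
    τ i = proj₁ (σ-onCycle σ aut (i , refl))

    c-τ : ∀ i → c (τ i) ≡ σ ⟨$⟩ʳ c i
    c-τ i = proj₂ (σ-onCycle σ aut (i , refl))

    τ-injective : ∀ {i j} → τ i ≡ τ j → i ≡ j
    τ-injective {i} {j} eq =
      inj C (perm-injective {G} σ (trans (≡-sym (c-τ i)) (trans (cong c eq) (c-τ j))))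

    τ-adjacency : ∀ i → τ (prev i) ≡ prev (τ i) ⊎ prev (τ (prev i)) ≡ τ i
    τ-adjacency i = compare (proj₂ (σ-cycleEdge σ aut i))
      where
      compare : ∀ {j} → MapsEdge σ i j → τ (prev i) ≡ prev (τ i) ⊎ prev (τ (prev i)) ≡ τ i
      compare (inj₁ (p , q)) = inj₁ (trans (inj C (trans (c-τ (prev i)) p))
                                           (cong prev (≡-sym (inj C (trans (c-τ i) q)))))
      compare (inj₂ (p , q)) = inj₂ (trans (cong prev (inj C (trans (c-τ (prev i)) q)))
                                           (≡-sym (inj C (trans (c-τ i) p))))

    τ-dihedral : ∃ λ τᵉ → Dihedral τ τᵉ × ∀ i → MapsEdge σ i (τᵉ i)
    τ-dihedral with adjacency-preserving⇒dihedral (k≥2 C) τ τ-injective τ-adjacency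
    ... | inj₁ rot = τ , rotation rot , λ i →
            inj₁ (trans (≡-sym (c-τ (prev i))) (cong c (rot i)) , ≡-sym (c-τ i))
    -- A reflection swaps the ends of the edge, so the later end of the image of edge `i` is
    -- `τ (prev i)`.
    ... | inj₂ ref = τ ∘ prev , reflection ref , λ i →
            inj₂ (trans (≡-sym (c-τ i)) (cong c (≡-sym (ref i))) , ≡-sym (c-τ (prev i)))

    τᵉ : Fin (suc (k C)) → Fin (suc (k C))
    τᵉ = proj₁ τ-dihedral

    dihedral : Dihedral τ τᵉ
    dihedral = proj₁ (proj₂ τ-dihedral)

    maps-τᵉ : ∀ i → MapsEdge σ i (τᵉ i)
    maps-τᵉ = proj₂ (proj₂ τ-dihedral)

  -- Transfer of labellings

  glue : {A : Set} → (V → A) → (Fin (suc (k C)) → A) → V → A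
  glue f h v with onCycle? v
  ... | yes (i , _) = h i
  ... | no  _       = f v

  glue-on : ∀ {A} (f : V → A) h i → glue f h (c i) ≡ h i
  glue-on f h i with onCycle? (c i)
  ... | yes (j , eq) = cong h (inj C eq)
  ... | no  off      = ⊥-elim (off (i , refl))

  glue-off : ∀ {A} (f : V → A) h {v} → ¬ OnCycle v → glue f h v ≡ f v
  glue-off f h {v} off with onCycle? v
  ... | yes on = ⊥-elim (off on)
  ... | no  _  = refl

  -- On edges this inverts the assignment of `{v , par v}` to `v`; the values on other pairs do not
  -- matter.
  child : V → V → V
  child u v with v ≟ᶠ par u
  ... | yes _ = u
  ... | no  _ = v

  child-par : ∀ v → child v (par v) ≡ v
  child-par v with par v ≟ᶠ par v
  ... | yes _ = refl
  ... | no ¬p = ⊥-elim (¬p refl)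

  par-child : ∀ v → child (par v) v ≡ v
  par-child v with v ≟ᶠ par (par v)
  ... | yes p = ⊥-elim (par²≢id v (≡-sym p))
  ... | no _  = refl

  child-sym : ∀ {u v} → Edge G u v → child u v ≡ child v u
  child-sym e with edge-par e
  ... | inj₁ refl = trans (child-par _) (≡-sym (par-child _))
  ... | inj₂ refl = trans (par-child _) (≡-sym (child-par _))

  child-c : ∀ i → child (c i) (c (prev i)) ≡ c i
  child-c i = subst (λ x → child (c i) x ≡ c i) (par-c i) (child-par (c i))

  -- Off the cycle an edge takes the label of its child; cycle edges take the replacement `h` of the
  -- cycle labels. Preserving `g` then forces preserving `f`, on the cycle by `sim` and elsewhere by
  -- `σ-par`.
  vertex⇒edge : ∀ {r} → HasDistVertexLabeling G r → HasDistEdgeLabeling G r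
  vertex⇒edge {r} (f , dist) with h , sim ← simulatedOnEdges (k≥2 C) r (f ∘ c) =
    g , g-sym , dist′
    where
    g : V → V → Fin r
    g u v = glue f h (child u v)

    g-sym : IsEdgeLabeling G r g
    g-sym u v e = cong (glue f h) (child-sym e)

    g-cycle : ∀ i → g (c i) (c (prev i)) ≡ h i
    g-cycle i = trans (cong (glue f h) (child-c i)) (glue-on f h i)

    g-par : ∀ {v} → ¬ OnCycle v → g v (par v) ≡ f v
    g-par off = trans (cong (glue f h) (child-par _)) (glue-off f h off)

    dist′ : DistEdgeLabeling G r g
    dist′ σ aut pres = dist σ aut preserved
      where
      open Automorphism σ aut

      h-preserved : Preserves h τᵉ
      h-preserved i = trans (≡-sym (g-cycle (τᵉ i)))
        (trans (≡-sym (mapsEdge-label σ i g-sym (maps-τᵉ i)))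
          (trans (pres _ _ (edge-sym {G} (prev-edge C i))) (g-cycle i)))

      preserved : ∀ v → f (σ ⟨$⟩ʳ v) ≡ f v
      preserved v with onCycle? v
      ... | yes (i , refl) = trans (cong f (≡-sym (c-τ i))) (sim dihedral h-preserved i)
      ... | no off = trans (≡-sym (g-par (σ-offCycle off)))
                       (trans (cong (g _) (σ-par off))
                         (trans (pres _ _ (par-edge v)) (g-par off)))

  -- The reverse transfer: off the cycle a vertex takes the label of its parent edge. Preservation
  -- has to be checked on parent edges only, by `edge-par`.
  edge⇒vertex : ∀ {r} → HasDistEdgeLabeling G r → HasDistVertexLabeling G r
  edge⇒vertex {r} (g , g-sym , dist)
    with h , sim ← simulatedOnVertices (k≥2 C) r (λ i → g (c i) (c (prev i))) = f , dist′
    where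
    f : V → Fin r
    f = glue (λ v → g v (par v)) h

    dist′ : DistVertexLabeling G r f
    dist′ σ aut pres = dist σ aut preserved
      where
      open Automorphism σ aut

      h-preserved : Preserves h τ
      h-preserved i = trans (≡-sym (glue-on _ h (τ i)))
        (trans (cong f (c-τ i)) (trans (pres (c i)) (glue-on _ h i)))

      par-preserved : ∀ v → g (σ ⟨$⟩ʳ v) (σ ⟨$⟩ʳ par v) ≡ g v (par v)
      par-preserved v with onCycle? v
      ... | no off = trans (cong (g _) (≡-sym (σ-par off)))
                       (trans (≡-sym (glue-off _ h (σ-offCycle off)))
                         (trans (pres v) (glue-off _ h off)))
      ... | yes (i , refl) = subst (λ x → g (σ ⟨$⟩ʳ c i) (σ ⟨$⟩ʳ x) ≡ g (c i) x) (≡-sym (par-c i))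
          (trans (mapsEdge-label σ i g-sym (maps-τᵉ i)) (sim dihedral h-preserved i))

      preserved : ∀ u v → Edge G u v → g (σ ⟨$⟩ʳ u) (σ ⟨$⟩ʳ v) ≡ g u v
      preserved u v e with edge-par e
      ... | inj₁ refl = par-preserved u
      ... | inj₂ refl = trans (g-sym _ _ (aut-edge {G} {σ} aut e))
                          (trans (par-preserved v) (g-sym _ _ (edge-sym {G} e)))

-- Decidability of the distinguishing number

-- `finToFun` reaches each function up to pointwise equality, hence the condition that `P` respects
-- it.
any-function? : ∀ {m r} {P : (Fin m → Fin r) → Set} → (∀ {f g} → f ≗ g → P f → P g) →
                (∀ f → Dec (P f)) → Dec (∃ P)
any-function? resp P? = map′ (λ (x , p) → finToFun x , p)
  (λ (f , p) → funToFin f , resp (λ i → ≡-sym (finToFun-funToFin f i)) p)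
  (any? λ x → P? (finToFun x))

all-functions? : ∀ {m r} {P : (Fin m → Fin r) → Set} → (∀ {f g} → f ≗ g → P f → P g) →
                 (∀ f → Dec (P f)) → Dec (∀ f → P f)
all-functions? resp P? = map′ (λ p f → resp (finToFun-funToFin f) (p (funToFin f)))
  (λ p x → p (finToFun x)) (all? λ x → P? (finToFun x))

module _ (G : Graph) where

  private
    V : Set
    V = Fin (n G)

  -- Quantifying over s together with its inverse t ranges over permutations
  -- while keeping both quantifiers over finite function types.
  Distinguishing : ∀ {r} → (V → Fin r) → (V → V) → (V → V) → Set
  Distinguishing f s t = (∀ i → s (t i) ≡ i) → (∀ i → t (s i) ≡ i) →
    (∀ u v → Adj G (s u) (s v) ≡ Adj G u v) → (∀ v → f (s v) ≡ f v) → ∀ v → s v ≡ v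

  distinguishing-resp : ∀ {r} {f f′ : V → Fin r} {s s′ t t′} → f ≗ f′ → s ≗ s′ → t ≗ t′ →
                        Distinguishing f s t → Distinguishing f′ s′ t′
  distinguishing-resp {f = f} {f′} {s} {s′} {t} {t′} f≗ s≗ t≗ dist st ts aut pres v =
    trans (≡-sym (s≗ v)) (dist
      (λ i → trans (s≗ (t i)) (trans (cong s′ (t≗ i)) (st i)))
      (λ i → trans (t≗ (s i)) (trans (cong t′ (s≗ i)) (ts i)))
      (λ u v → trans (cong₂ (Adj G) (s≗ u) (s≗ v)) (aut u v))
      (λ v → trans (f≗ (s v)) (trans (cong f′ (s≗ v)) (trans (pres v) (≡-sym (f≗ v)))))
      v)

  distinguishing? : ∀ {r} (f : V → Fin r) s t → Dec (Distinguishing f s t)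
  distinguishing? f s t =
    all? (λ i → s (t i) ≟ᶠ i) →-dec all? (λ i → t (s i) ≟ᶠ i) →-dec
    all? (λ u → all? λ v → Adj G (s u) (s v) Bool.≟ Adj G u v) →-dec
    all? (λ v → f (s v) ≟ᶠ f v) →-dec all? (λ v → s v ≟ᶠ v)

  distVertexLabeling? : ∀ {r} (f : V → Fin r) → Dec (DistVertexLabeling G r f)
  distVertexLabeling? f = map′
    (λ dist σ aut pres → dist (σ ⟨$⟩ʳ_) (σ ⟨$⟩ˡ_) (λ _ → inverseʳ σ) (λ _ → inverseˡ σ) aut pres)
    (λ dist s t st ts aut pres → dist (permutation s t st ts) aut pres)
    (all-functions? (λ s≗ dist t → distinguishing-resp (λ _ → refl) s≗ (λ _ → refl) (dist t)) λ s →
     all-functions? (λ t≗ → distinguishing-resp (λ _ → refl) (λ _ → refl) t≗) λ t →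
     distinguishing? f s t)

  hasDistVertexLabeling? : ∀ r → Dec (HasDistVertexLabeling G r)
  hasDistVertexLabeling? r = any-function?
    (λ {f} {g} f≗g dist σ aut pres →
       dist σ aut λ v → trans (f≗g _) (trans (pres v) (≡-sym (f≗g v))))
    distVertexLabeling?

theorem2 : (G : Graph) → Connected G → Unicyclic G →
    Σ ℕ (λ r → IsDistIndex G r × IsDistNumber G r)
-- The injective labelling `id` with `n G` labels bounds the search. Both kinds of labelling exist
-- for the same numbers of labels, so the least numbers agree.
theorem2 G connected (C , unique)
  with least (hasDistVertexLabeling? G) (n G) (id , λ _ _ pres → pres)
... | r , has , minimal = r , (vertex⇒edge has , λ s e → minimal s (edge⇒vertex e)) , has , minimal
  where open UnicyclicGraph G connected C unique
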